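{- Let $h:\mathbb N\to\mathbb N$ be a strictly increasing function and $\alpha,\beta$ ordinals below $\varepsilon_0$ (with $\beta+1+\alpha<\varepsilon_0$). (i) If $h\in\mathscr F_\beta$, then $\mathbf F_{h,\alpha}\subseteq\mathbf F_{\beta+1+\alpha}$. (ii) If $h(x)\le F_\beta(x)$ for all $x\in\mathbb N$, then $\mathbf F_{h,\alpha}\subseteq\mathbf F_{\beta+\alpha}$.
   Context: Ordinals are below $\varepsilon_0$ in Cantor normal form; ordinal addition is the usual (non-commutative) one. Each limit ordinal $\lambda$ has the fundamental sequence $(\gamma+\omega^{\beta+1})(x)=\gamma+\omega^\beta\cdot(x+1)$, $(\gamma+\omega^{\lambda'})(x)=\gamma+\omega^{\lambda'(x)}$ for $\lambda'$ limit. Fast-growing functions: $F_0(x)=x+1$, $F_{\alpha+1}(x)=F_\alpha^{x+1}(x)$, $F_\lambda(x)=F_{\lambda(x)}(x)$. Relativized fast-growing functions for $h:\mathbb N\to\mathbb N$: $F_{h,0}(x)=h(x)$, $F_{h,\alpha+1}(x)=F_{h,\alpha}^{x+1}(x)$, $F_{h,\lambda}(x)=F_{h,\lambda(x)}(x)$. Extended Grzegorczyk class $\mathscr F_\alpha$: smallest class of functions $\mathbb N^k\to\mathbb N$ containing the zero function, addition, projections and $F_\alpha$, closed under composition and limited primitive recursion (primitive recursion whose result is bounded by $g(\max$ of arguments$)$ for some $g$ in the class). $\mathscr F_{<\alpha}=\bigcup_{\beta<\alpha}\mathscr F_\beta$. $\mathrm{DTime}(t(n))$: languages decided by a deterministic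 Turing machine in at most $t(n)$ steps on inputs of length $n$. Complexity classes: $\mathbf F_\alpha=\bigcup_{p\in\mathscr F_{<\alpha}}\mathrm{DTime}(F_\alpha(p(n)))$ and $\mathbf F_{h,\alpha}=\bigcup_{p\in\mathscr F_{<\alpha}}\mathrm{DTime}(F_{h,\alpha}(p(n)))$, with $p$ unary. -}

module Defs where

open import Data.Nat using (ℕ; zero; suc; _+_; _≤_; _<_; _⊔_)
open import Data.Fin using (Fin)
open import Data.Vec using (Vec; []; _∷_; lookup; tabulate; head; tail)
open import Data.List using (List; []; _∷_; length)
open import Data.Bool using (Bool; true; false)
open import Data.Maybe using (Maybe; just; nothing)
open import Data.Sum using (_⊎_)
open import Data.Product using (Σ; _×_; _,_)
open import Data.Unit using (⊤)
open import Relation.Binary.PropositionalEquality using (_≡_)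

-- Ordinal notations below ε₀ in Cantor normal form.
-- ω^ a ⊕ b  denotes  ω^a + b ; a term is in CNF when the exponents
-- are (weakly) decreasing from left to right (predicate CNF below).

data OT : Set where
  𝟎 : OT
  ω^_⊕_ : OT → OT → OT

data Cmp : Set where
  lt eq gt : Cmp

lex : Cmp → Cmp → Cmp
lex lt _ = lt
lex gt _ = gt
lex eq r = r

cmp : OT → OT → Cmp
cmp 𝟎 𝟎 = eq
cmp 𝟎 (ω^ _ ⊕ _) = lt
cmp (ω^ _ ⊕ _) 𝟎 = gt
cmp (ω^ a ⊕ b) (ω^ c ⊕ d) = lex (cmp a c) (cmp b d)

_<ₒ_ : OT → OT → Set
a <ₒ b = cmp a b ≡ lt

_≤ₒ_ : OT → OT → Set
a ≤ₒ b = (cmp a b ≡ lt) ⊎ (cmp a b ≡ eq)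

LeadLE : OT → OT → Set
LeadLE 𝟎 _ = ⊤
LeadLE (ω^ c ⊕ _) a = c ≤ₒ a

data CNF : OT → Set where
  cnf𝟎 : CNF 𝟎
  cnfω : ∀ {a b} → CNF a → CNF b → LeadLE b a → CNF (ω^ a ⊕ b)

pickAdd : Cmp → OT → OT → OT
pickAdd lt c r = c
pickAdd eq c r = r
pickAdd gt c r = r

addω : OT → OT → OT → OT
addω a bc 𝟎 = ω^ a ⊕ bc
addω a bc (ω^ e ⊕ f) = pickAdd (cmp a e) (ω^ e ⊕ f) (ω^ a ⊕ bc)

infixl 6 _+ₒ_
_+ₒ_ : OT → OT → OT
𝟎 +ₒ c = c
(ω^ a ⊕ b) +ₒ c = addω a (b +ₒ c) c

oneₒ : OT
oneₒ = ω^ 𝟎 ⊕ 𝟎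

data Kind : Set where
  isZero : Kind
  isSucc : OT → Kind
  isLim  : Kind

liftK : OT → Kind → Kind
liftK 𝟎 isZero = isSucc 𝟎
liftK (ω^ _ ⊕ _) isZero = isLim
liftK a (isSucc p) = isSucc (ω^ a ⊕ p)
liftK a isLim = isLim

kind : OT → Kind
kind 𝟎 = isZero
kind (ω^ a ⊕ b) = liftK a (kind b)

rep : OT → ℕ → OT
rep p zero = 𝟎
rep p (suc n) = ω^ p ⊕ rep p n

-- fundamental sequences:
--   (γ + ω^(β+1))(x) = γ + ω^β·(x+1),   (γ + ω^λ')(x) = γ + ω^(λ'(x))
mutual
  fs : OT → ℕ → OT
  fs 𝟎 x = 𝟎
  fs (ω^ a ⊕ 𝟎) x = fsK a (kind a) x
  fs (ω^ a ⊕ (ω^ c ⊕ d)) x = ω^ a ⊕ fs (ω^ c ⊕ d) x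

  fsK : OT → Kind → ℕ → OT
  fsK a isZero x = 𝟎
  fsK a (isSucc p) x = rep p (suc x)
  fsK a isLim x = ω^ (fs a x) ⊕ 𝟎

-- Relativized fast-growing functions, given by their graph:
-- FG h α x y  means  F_{h,α}(x) = y.
-- (The graph is total and functional on CNF ordinals.)
--   F_{h,0}(x) = h(x),  F_{h,α+1}(x) = F_{h,α}^{x+1}(x),  F_{h,λ}(x) = F_{h,λ(x)}(x)

mutual
  data FG (h : ℕ → ℕ) : OT → ℕ → ℕ → Set where
    fg𝟎   : ∀ {x} → FG h 𝟎 x (h x)
    fgSuc : ∀ {α p x y} → kind α ≡ isSucc p → Iter h p (suc x) x y → FG h α x y
    fgLim : ∀ {α x y} → kind α ≡ isLim → FG h (fs α x) x y → FG h α x y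

  data Iter (h : ℕ → ℕ) (p : OT) : ℕ → ℕ → ℕ → Set where
    it0 : ∀ {x} → Iter h p zero x x
    itS : ∀ {n x y z} → Iter h p n x y → FG h p y z → Iter h p (suc n) x z

FF : OT → ℕ → ℕ → Set
FF = FG suc

maxV : ∀ {k} → Vec ℕ k → ℕ
maxV [] = 0
maxV (x ∷ v) = x ⊔ maxV v

primrec : ∀ {k} → (Vec ℕ k → ℕ) → (Vec ℕ (suc (suc k)) → ℕ) → Vec ℕ (suc k) → ℕ
primrec g s (zero ∷ xs) = g xs
primrec g s (suc y ∷ xs) = s (y ∷ primrec g s (y ∷ xs) ∷ xs)

data Grz (α : OT) : (k : ℕ) → (Vec ℕ k → ℕ) → Set where
  gZero : ∀ {k} → Grz α k (λ _ → 0)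
  gAdd  : Grz α 2 (λ v → head v + head (tail v))
  gProj : ∀ {k} (i : Fin k) → Grz α k (λ v → lookup v i)
  gF    : (f : ℕ → ℕ) → (∀ x → FF α x (f x)) → Grz α 1 (λ v → f (head v))
  gComp : ∀ {k m f} {gs : Fin m → Vec ℕ k → ℕ} →
          Grz α m f → (∀ i → Grz α k (gs i)) →
          Grz α k (λ v → f (tabulate (λ i → gs i v)))
  gLPR  : ∀ {k g s b} → Grz α k g → Grz α (suc (suc k)) s → Grz α 1 b →
          (∀ v → primrec g s v ≤ b (maxV v ∷ [])) →
          Grz α (suc k) (primrec g s)
  gExt  : ∀ {k f g} → Grz α k f → (∀ v → f v ≡ g v) → Grz α k g

_∈𝓕_ : (ℕ → ℕ) → OT → Set
f ∈𝓕 α = Grz α 1 (λ v → f (head v))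

_∈𝓕<_ : (ℕ → ℕ) → OT → Set
f ∈𝓕< α = Σ OT (λ β → CNF β × β <ₒ α × f ∈𝓕 β)

-- Deterministic single-tape Turing machines (tape infinite in both
-- directions), input alphabet Fin σ.

data Move : Set where
  mvL mvR mvS : Move

data St (Q : ℕ) : Set where
  go   : Fin Q → St Q
  halt : Bool → St Q

-- tape symbols: nothing = blank, input letters, extra work symbols
Sym : ℕ → ℕ → Set
Sym σ Γ = Maybe (Fin σ ⊎ Fin Γ)

record TM (σ : ℕ) : Set where
  field
    Q     : ℕ
    Γ     : ℕ
    start : St Q
    δ     : Fin Q → Sym σ Γ → St Q × Sym σ Γ × Move

record Config (σ Γ Q : ℕ) : Set where
  constructor conf
  field
    state : St Q
    left  : List (Sym σ Γ)    -- cells to the left of the head, nearest first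
    cur   : Sym σ Γ
    right : List (Sym σ Γ)    -- cells to the right of the head, nearest first

module _ {σ : ℕ} (M : TM σ) where
  open TM M

  moveHead : St Q → List (Sym σ Γ) → Sym σ Γ → List (Sym σ Γ) → Move → Config σ Γ Q
  moveHead q ls s rs mvS = conf q ls s rs
  moveHead q [] s rs mvL = conf q [] nothing (s ∷ rs)
  moveHead q (l ∷ ls) s rs mvL = conf q ls l (s ∷ rs)
  moveHead q ls s [] mvR = conf q (s ∷ ls) nothing []
  moveHead q ls s (r ∷ rs) mvR = conf q (s ∷ ls) r rs

  apply : List (Sym σ Γ) → List (Sym σ Γ) → St Q × Sym σ Γ × Move → Config σ Γ Q
  apply ls rs (q , s , m) = moveHead q ls s rs m

  step : Config σ Γ Q → Config σ Γ Q
  step (conf (halt b) ls c rs) = conf (halt b) ls c rs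
  step (conf (go q) ls c rs) = apply ls rs (δ q c)

  run : ℕ → Config σ Γ Q → Config σ Γ Q
  run zero c = c
  run (suc n) c = run n (step c)

  inp : List (Fin σ) → List (Sym σ Γ)
  inp [] = []
  inp (a ∷ w) = just (Data.Sum.inj₁ a) ∷ inp w

  initConf : List (Fin σ) → Config σ Γ Q
  initConf [] = conf start [] nothing []
  initConf (a ∷ w) = conf start [] (just (Data.Sum.inj₁ a)) (inp w)

Lang : ℕ → Set
Lang σ = List (Fin σ) → Bool

-- M decides L within time bound described by the relation T n t
-- ("t is the time bound for inputs of length n"): halting is absorbing,
-- so being halted after t steps means having halted within ≤ t steps.
DecidesIn : ∀ {σ} → TM σ → (ℕ → ℕ → Set) → Lang σ → Set
DecidesIn M T L = ∀ w → Σ ℕ (λ t → T (length w) t ×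
                    Config.state (run M t (initConf M w)) ≡ halt (L w))

𝐅ʰ[_,_] : (ℕ → ℕ) → OT → (σ : ℕ) → Lang σ → Set
𝐅ʰ[ h , α ] σ L = Σ (ℕ → ℕ) (λ p → p ∈𝓕< α ×
                   Σ (TM σ) (λ M → DecidesIn M (λ n t → FG h α (p n) t) L))

𝐅[_] : OT → (σ : ℕ) → Lang σ → Set
𝐅[ α ] = 𝐅ʰ[ suc , α ]

StrictlyIncreasing : (ℕ → ℕ) → Set
StrictlyIncreasing h = ∀ {x y} → x < y → h x < h y

{-# OPTIONS --safe #-}

-- If G is a function with G ∘ h ≤ F_β ∘ G and G x ≥ x + K, then G (F_{h,α} x) ≤ F_{β+α} (G x)
-- by induction on α.  Successor steps iterate the inequality.  At a limit, β + α(x) lies below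
-- β + α, though absorption may keep it off the fundamental sequence of β + α; its coefficients
-- are at most G x, provided K is large enough in terms of α and β, so it is still reached from
-- β + α at argument G x and F_{β+α(x)} (G x) ≤ F_{β+α} (G x).  It is enough that
-- the inequality holds at α = 1.  Part (ii) takes G x = x + K.  In part (i) h is bounded by an
-- iterate of f = F_{β+1}, so F_{h,1} x is bounded by about c (x+1) iterations of f, which
-- G x = 2^m (x+1) absorbs.  Finally p ∈ 𝓕_γ is bounded by an iterate of F_γ x + x, hence by
-- an iterate of F_{β+γ} x + x, which lies in 𝓕_{β+γ} with β + γ < β + α.
module Submission where

open import Defs
open import Data.Nat using (ℕ; zero; suc; _+_; _*_; _^_; _∸_; _⊔_;
  _≤_; _<_; z≤n; s≤s; _≤′_; ≤′-reflexive; ≤′-step)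
open import Data.Nat.Properties
open import Data.Nat.GeneralisedArithmetic using (fold; fold-+)
open import Data.Fin using (Fin; zero; suc)
open import Data.Vec using (Vec; []; _∷_; head; lookup; tabulate)
open import Data.Vec.Properties using (lookup∘tabulate)
open import Algebra.Properties.CommutativeSemigroup +-commutativeSemigroup
  using (x∙yz≈y∙xz; xy∙z≈xz∙y; xy∙z≈x∙zy)
open import Data.List using (length)
open import Data.Product using (Σ; ∃; ∃-syntax; _×_; _,_; proj₁; proj₂)
open import Data.Sum using (_⊎_; inj₁; inj₂)
open import Data.Unit using (⊤; tt)
open import Relation.Nullary using (¬_; contradiction)
open import Relation.Binary.PropositionalEquality

-- Ordinal notations

infix 4 _≺_

-- Inductive form of `_<ₒ_`, for case analysis. Outside CNF it is not well-founded; induction on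
-- ordinals runs along `Wf` instead.
data _≺_ : OT → OT → Set where
  𝟎≺   : ∀ {a b} → 𝟎 ≺ ω^ a ⊕ b
  lead : ∀ {a b c d} → a ≺ c → ω^ a ⊕ b ≺ ω^ c ⊕ d
  tail : ∀ {a b d} → b ≺ d → ω^ a ⊕ b ≺ ω^ a ⊕ d

≺⇒𝟎≺ : ∀ {a b} → a ≺ b → 𝟎 ≺ b
≺⇒𝟎≺ 𝟎≺ = 𝟎≺
≺⇒𝟎≺ (lead _) = 𝟎≺
≺⇒𝟎≺ (tail _) = 𝟎≺

data Comparison (a : OT) : OT → Cmp → Set where
  less    : ∀ {b} → a ≺ b → Comparison a b lt
  same    : Comparison a a eq
  greater : ∀ {b} → b ≺ a → Comparison a b gt

comparison : ∀ a b → Comparison a b (cmp a b)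
comparison 𝟎 𝟎 = same
comparison 𝟎 (ω^ _ ⊕ _) = less 𝟎≺
comparison (ω^ _ ⊕ _) 𝟎 = greater 𝟎≺
comparison (ω^ a ⊕ b) (ω^ c ⊕ d) with cmp a c | comparison a c
... | lt | less p = less (lead p)
... | gt | greater p = greater (lead p)
... | eq | same with cmp b d | comparison b d
...   | lt | less p = less (tail p)
...   | eq | same = same
...   | gt | greater p = greater (tail p)

<ₒ⇒≺ : ∀ {a b} → a <ₒ b → a ≺ b
<ₒ⇒≺ {a} {b} p with cmp a b | comparison a b
<ₒ⇒≺ refl | _ | less q = q

cmp-refl : ∀ a → cmp a a ≡ eq
cmp-refl 𝟎 = refl
cmp-refl (ω^ a ⊕ b) rewrite cmp-refl a = cmp-refl b

≺⇒<ₒ : ∀ {a b} → a ≺ b → a <ₒ b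
≺⇒<ₒ 𝟎≺ = refl
≺⇒<ₒ (lead p) rewrite ≺⇒<ₒ p = refl
≺⇒<ₒ (tail {a} p) rewrite cmp-refl a = ≺⇒<ₒ p

≺-trans : ∀ {a b c} → a ≺ b → b ≺ c → a ≺ c
≺-trans 𝟎≺ (lead _) = 𝟎≺
≺-trans 𝟎≺ (tail _) = 𝟎≺
≺-trans (lead p) (lead q) = lead (≺-trans p q)
≺-trans (lead p) (tail _) = lead p
≺-trans (tail _) (lead q) = lead q
≺-trans (tail p) (tail q) = tail (≺-trans p q)

≺-irrefl : ∀ {a} → ¬ a ≺ a
≺-irrefl (lead p) = ≺-irrefl p
≺-irrefl (tail p) = ≺-irrefl p

≤ₒ⇒≺⊎≡ : ∀ {a b} → a ≤ₒ b → a ≺ b ⊎ a ≡ b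
≤ₒ⇒≺⊎≡ {a} {b} p with cmp a b | comparison a b
≤ₒ⇒≺⊎≡ _ | _ | less q = inj₁ q
≤ₒ⇒≺⊎≡ _ | _ | same = inj₂ refl
≤ₒ⇒≺⊎≡ (inj₁ ()) | _ | greater _
≤ₒ⇒≺⊎≡ (inj₂ ()) | _ | greater _

data IsSuc : OT → OT → Set where
  one  : IsSuc oneₒ 𝟎
  cons : ∀ {a b p} → IsSuc b p → IsSuc (ω^ a ⊕ b) (ω^ a ⊕ p)

data IsLim : OT → Set where
  ω-suc : ∀ {a p} → IsSuc a p → IsLim (ω^ a ⊕ 𝟎)
  ω-lim : ∀ {a} → IsLim a → IsLim (ω^ a ⊕ 𝟎)
  cons  : ∀ {a b} → IsLim b → IsLim (ω^ a ⊕ b)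

kind-suc : ∀ {a p} → IsSuc a p → kind a ≡ isSucc p
kind-suc one = refl
kind-suc (cons {𝟎} s) rewrite kind-suc s = refl
kind-suc (cons {ω^ _ ⊕ _} s) rewrite kind-suc s = refl

kind-lim : ∀ {a} → IsLim a → kind a ≡ isLim
kind-lim (ω-suc one) = refl
kind-lim (ω-suc (cons _)) = refl
kind-lim (ω-lim (ω-suc _)) = refl
kind-lim (ω-lim (ω-lim _)) = refl
kind-lim (ω-lim (cons _)) = refl
kind-lim (cons {𝟎} l) rewrite kind-lim l = refl
kind-lim (cons {ω^ _ ⊕ _} l) rewrite kind-lim l = refl

fs-ω-suc : ∀ {a p} x → IsSuc a p → fs (ω^ a ⊕ 𝟎) x ≡ rep p (suc x)
fs-ω-suc x s rewrite kind-suc s = refl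

fs-ω-lim : ∀ {a} x → IsLim a → fs (ω^ a ⊕ 𝟎) x ≡ ω^ (fs a x) ⊕ 𝟎
fs-ω-lim x l rewrite kind-lim l = refl

fs-cons : ∀ {a b} x → IsLim b → fs (ω^ a ⊕ b) x ≡ ω^ a ⊕ fs b x
fs-cons {b = ω^ _ ⊕ _} x _ = refl

pred≺ : ∀ {a p} → IsSuc a p → p ≺ a
pred≺ one = 𝟎≺
pred≺ (cons s) = tail (pred≺ s)

fs≺ : ∀ {a} x → IsLim a → fs a x ≺ a
fs≺ x (ω-suc s) rewrite fs-ω-suc x s = lead (pred≺ s)
fs≺ x (ω-lim l) rewrite fs-ω-lim x l = lead (fs≺ x l)
fs≺ {ω^ a ⊕ b} x (cons l) rewrite fs-cons {a} x l = tail (fs≺ x l)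

fs-positive : ∀ {a} x → IsLim a → 𝟎 ≺ fs a x
fs-positive x (ω-suc s) rewrite fs-ω-suc x s = 𝟎≺
fs-positive x (ω-lim l) rewrite fs-ω-lim x l = 𝟎≺
fs-positive {ω^ a ⊕ b} x (cons l) rewrite fs-cons {a} x l = 𝟎≺

-- Induction along predecessors and fundamental sequences

data Wf : OT → Set where
  wf-𝟎   : Wf 𝟎
  wf-suc : ∀ {a p} → IsSuc a p → Wf p → Wf a
  wf-lim : ∀ {a} → IsLim a → (∀ x → Wf (fs a x)) → Wf a

infixl 6 _⌢_

-- Unlike _+ₒ_, concatenation absorbs nothing, so it commutes with fundamental sequences.
_⌢_ : OT → OT → OT
𝟎 ⌢ c = c
(ω^ a ⊕ b) ⌢ c = ω^ a ⊕ (b ⌢ c)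

⌢-identityʳ : ∀ a → a ⌢ 𝟎 ≡ a
⌢-identityʳ 𝟎 = refl
⌢-identityʳ (ω^ a ⊕ b) = cong (ω^ a ⊕_) (⌢-identityʳ b)

⌢-assoc : ∀ a b c → (a ⌢ b) ⌢ c ≡ a ⌢ (b ⌢ c)
⌢-assoc 𝟎 b c = refl
⌢-assoc (ω^ a ⊕ a′) b c = cong (ω^ a ⊕_) (⌢-assoc a′ b c)

⌢-suc : ∀ a {b p} → IsSuc b p → IsSuc (a ⌢ b) (a ⌢ p)
⌢-suc 𝟎 s = s
⌢-suc (ω^ _ ⊕ a) s = cons (⌢-suc a s)

⌢-lim : ∀ a {b} → IsLim b → IsLim (a ⌢ b)
⌢-lim 𝟎 l = l
⌢-lim (ω^ _ ⊕ a) l = cons (⌢-lim a l)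

fs-⌢ : ∀ a {b} x → IsLim b → fs (a ⌢ b) x ≡ a ⌢ fs b x
fs-⌢ 𝟎 x l = refl
fs-⌢ (ω^ c ⊕ a) x l = trans (fs-cons x (⌢-lim a l)) (cong (ω^ c ⊕_) (fs-⌢ a x l))

wf-⌢rep : ∀ {p} → (∀ {c} → Wf c → Wf (c ⌢ (ω^ p ⊕ 𝟎))) → ∀ n {c} → Wf c → Wf (c ⌢ rep p n)
wf-⌢rep f zero {c} w = subst Wf (sym (⌢-identityʳ c)) w
wf-⌢rep {p} f (suc n) {c} w =
  subst Wf (⌢-assoc c (ω^ p ⊕ 𝟎) (rep p n)) (wf-⌢rep f n (f w))

-- Gentzen's jump, stated for every well-founded prefix `c`: at a successor exponent the fundamental
-- sequence appends `x + 1` copies of `ω^p`, and each copy extends the prefix for the next.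
wf-⌢ω : ∀ {a} → Wf a → ∀ {c} → Wf c → Wf (c ⌢ (ω^ a ⊕ 𝟎))
wf-⌢ω wf-𝟎 {c} w = wf-suc (⌢-suc c one) (subst Wf (sym (⌢-identityʳ c)) w)
wf-⌢ω (wf-suc {p = p} s v) {c} w = wf-lim (⌢-lim c (ω-suc s)) λ x →
  subst Wf (sym (trans (fs-⌢ c x (ω-suc s)) (cong (c ⌢_) (fs-ω-suc x s))))
    (wf-⌢rep (wf-⌢ω v) (suc x) w)
wf-⌢ω (wf-lim l v) {c} w = wf-lim (⌢-lim c (ω-lim l)) λ x →
  subst Wf (sym (trans (fs-⌢ c x (ω-lim l)) (cong (c ⌢_) (fs-ω-lim x l))))
    (wf-⌢ω (v x) w)

wf-⌢ : ∀ a {c} → Wf c → Wf (c ⌢ a)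
wf-⌢ 𝟎 {c} w = subst Wf (sym (⌢-identityʳ c)) w
wf-⌢ (ω^ a ⊕ b) {c} w =
  subst Wf (⌢-assoc c (ω^ a ⊕ 𝟎) b) (wf-⌢ b (wf-⌢ω (wf-⌢ a wf-𝟎) w))

wf : ∀ a → Wf a
wf a = wf-⌢ a wf-𝟎

-- Iteration

Inflationary Monotone : (ℕ → ℕ) → Set
Inflationary f = ∀ x → x ≤ f x
Monotone f = ∀ {x y} → x ≤ y → f x ≤ f y

fold-inflationary : ∀ {f} → Inflationary f → ∀ n x → x ≤ fold x f n
fold-inflationary fi zero x = ≤-refl
fold-inflationary fi (suc n) x = ≤-trans (fold-inflationary fi n x) (fi _)

fold-monoˡ : ∀ {f} → Monotone f → ∀ n {x y} → x ≤ y → fold x f n ≤ fold y f n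
fold-monoˡ fm zero x≤y = x≤y
fold-monoˡ fm (suc n) x≤y = fm (fold-monoˡ fm n x≤y)

fold-monoʳ : ∀ {f} → Inflationary f → ∀ {x m n} → m ≤ n → fold x f m ≤ fold x f n
fold-monoʳ {f} fi {x} {m} {n} m≤n = subst (λ k → fold x f m ≤ fold x f k) (m∸n+n≡m m≤n)
  (subst (fold x f m ≤_) (sym (fold-+ x f (n ∸ m))) (fold-inflationary fi (n ∸ m) _))

-- The iterates of an inflationary `f` stay above `x`, so `e` is asked only for `z` with `x ≤ z`. In
-- the comparison of `F_{h,α}` with `F_{β+α}` the norm condition is known just for such arguments.
fold-transfer : ∀ {f g} (G : ℕ → ℕ) → Inflationary f → Monotone g → ∀ {x} →
  (∀ {z} → x ≤ z → G (f z) ≤ g (G z)) → ∀ n → G (fold x f n) ≤ fold (G x) g n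
fold-transfer G fi gm e zero = ≤-refl
fold-transfer G fi gm e (suc n) =
  ≤-trans (e (fold-inflationary fi n _)) (gm (fold-transfer G fi gm e n))

fold-tail : ∀ (f : ℕ → ℕ) n {x} → fold x f (suc n) ≡ fold (f x) f n
fold-tail f n {x} = trans (cong (fold x f) (+-comm 1 n)) (fold-+ x f n)

fold-advance : ∀ {f} → (∀ x → x < f x) → ∀ n x → x + n ≤ fold x f n
fold-advance fi zero x = ≤-reflexive (+-identityʳ x)
fold-advance fi (suc n) x =
  ≤-trans (≤-reflexive (+-suc x n)) (≤-trans (s≤s (fold-advance fi n x)) (fi _))

-- Relativized fast-growing functions

module _ (h : ℕ → ℕ) where

  mutual
    FG-functional : ∀ {a x y z} → FG h a x y → FG h a x z → y ≡ z
    FG-functional fg𝟎 fg𝟎 = refl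
    FG-functional fg𝟎 (fgSuc () _)
    FG-functional fg𝟎 (fgLim () _)
    FG-functional (fgSuc () _) fg𝟎
    FG-functional (fgLim () _) fg𝟎
    FG-functional (fgSuc k i) (fgSuc k′ j) with trans (sym k) k′
    ... | refl = Iter-functional i j
    FG-functional (fgSuc k _) (fgLim k′ _) with trans (sym k) k′
    ... | ()
    FG-functional (fgLim k _) (fgSuc k′ _) with trans (sym k) k′
    ... | ()
    FG-functional (fgLim _ i) (fgLim _ j) = FG-functional i j

    Iter-functional : ∀ {p n x y z} → Iter h p n x y → Iter h p n x z → y ≡ z
    Iter-functional it0 it0 = refl
    Iter-functional (itS i f) (itS j g) with Iter-functional i j
    ... | refl = FG-functional f g

  Iter-fold : ∀ {p f} → (∀ x → FG h p x (f x)) → ∀ n x → Iter h p n x (fold x f n)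
  Iter-fold f zero x = it0
  Iter-fold f (suc n) x = itS (Iter-fold f n x) (f _)

  FG-total : ∀ {a} → Wf a → ∀ x → ∃ (FG h a x)
  FG-total wf-𝟎 x = _ , fg𝟎
  FG-total (wf-suc s w) x =
    _ , fgSuc (kind-suc s) (Iter-fold (λ y → proj₂ (FG-total w y)) (suc x) x)
  FG-total (wf-lim l w) x with FG-total (w x) x
  ... | y , g = y , fgLim (kind-lim l) g

  F : OT → ℕ → ℕ
  F a x = proj₁ (FG-total (wf a) x)

  F-graph : ∀ a x → FG h a x (F a x)
  F-graph a x = proj₂ (FG-total (wf a) x)

  F-𝟎 : ∀ x → F 𝟎 x ≡ h x
  F-𝟎 x = FG-functional (F-graph 𝟎 x) fg𝟎

  F-suc : ∀ {a p} → IsSuc a p → ∀ x → F a x ≡ fold x (F p) (suc x)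
  F-suc {a} {p} s x =
    FG-functional (F-graph a x) (fgSuc (kind-suc s) (Iter-fold (F-graph p) (suc x) x))

  F-lim : ∀ {a} → IsLim a → ∀ x → F a x ≡ F (fs a x) x
  F-lim {a} l x = FG-functional (F-graph a x) (fgLim (kind-lim l) (F-graph (fs a x) x))

  module _ (h-infl : Inflationary h) where

    F-inflationary : ∀ {a} → Wf a → Inflationary (F a)
    F-inflationary wf-𝟎 x rewrite F-𝟎 x = h-infl x
    F-inflationary (wf-suc s w) x rewrite F-suc s x =
      fold-inflationary (F-inflationary w) (suc x) x
    F-inflationary (wf-lim l w) x rewrite F-lim l x = F-inflationary (w x) x

-- The pointwise ordering

infix 4 _⊑⟨_⟩_

data _⊑⟨_⟩_ (a : OT) (x : ℕ) : OT → Set where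
  ⊑-refl : a ⊑⟨ x ⟩ a
  ⊑-suc  : ∀ {b p} → IsSuc b p → a ⊑⟨ x ⟩ p → a ⊑⟨ x ⟩ b
  ⊑-lim  : ∀ {b} → IsLim b → a ⊑⟨ x ⟩ fs b x → a ⊑⟨ x ⟩ b

⊑-trans : ∀ {a b c x} → a ⊑⟨ x ⟩ b → b ⊑⟨ x ⟩ c → a ⊑⟨ x ⟩ c
⊑-trans p ⊑-refl = p
⊑-trans p (⊑-suc s q) = ⊑-suc s (⊑-trans p q)
⊑-trans p (⊑-lim l q) = ⊑-lim l (⊑-trans p q)

⊑-𝟎 : ∀ {a x} → Wf a → 𝟎 ⊑⟨ x ⟩ a
⊑-𝟎 wf-𝟎 = ⊑-refl
⊑-𝟎 (wf-suc s w) = ⊑-suc s (⊑-𝟎 w)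
⊑-𝟎 (wf-lim l w) = ⊑-lim l (⊑-𝟎 (w _))

⊑-cons : ∀ {a b c x} → b ⊑⟨ x ⟩ c → ω^ a ⊕ b ⊑⟨ x ⟩ ω^ a ⊕ c
⊑-cons ⊑-refl = ⊑-refl
⊑-cons (⊑-suc s p) = ⊑-suc (cons s) (⊑-cons p)
⊑-cons {a} {b} {x = x} (⊑-lim l p) =
  ⊑-lim (cons l) (subst (ω^ a ⊕ b ⊑⟨ x ⟩_) (sym (fs-cons x l)) (⊑-cons p))

-- At a successor exponent `p + 1` the fundamental sequence gives `x + 1` copies of `ω^p`, never
-- none; descending through all but the first leaves `ω^p`.
⊑-ω : ∀ {a b x} → a ⊑⟨ x ⟩ b → ω^ a ⊕ 𝟎 ⊑⟨ x ⟩ ω^ b ⊕ 𝟎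
⊑-ω ⊑-refl = ⊑-refl
⊑-ω {a} {x = x} (⊑-suc s p) = ⊑-lim (ω-suc s)
  (subst (ω^ a ⊕ 𝟎 ⊑⟨ x ⟩_) (sym (fs-ω-suc x s)) (⊑-trans (⊑-ω p) (⊑-cons (⊑-𝟎 (wf _)))))
⊑-ω {a} {x = x} (⊑-lim l p) = ⊑-lim (ω-lim l)
  (subst (ω^ a ⊕ 𝟎 ⊑⟨ x ⟩_) (sym (fs-ω-lim x l)) (⊑-ω p))

rep-⊑ : ∀ {a x} n → rep a n ⊑⟨ x ⟩ rep a (suc n)
rep-⊑ zero = ⊑-𝟎 (wf _)
rep-⊑ (suc n) = ⊑-cons (rep-⊑ n)

-- The Bachmann property of the fundamental sequences.
fs-⊑-suc : ∀ {a x} → IsLim a → ∀ n → fs a n ⊑⟨ x ⟩ fs a (suc n)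
fs-⊑-suc (ω-suc s) n rewrite fs-ω-suc n s | fs-ω-suc (suc n) s = rep-⊑ (suc n)
fs-⊑-suc (ω-lim l) n rewrite fs-ω-lim n l | fs-ω-lim (suc n) l = ⊑-ω (fs-⊑-suc l n)
fs-⊑-suc {ω^ a ⊕ b} (cons l) n rewrite fs-cons {a} n l | fs-cons {a} (suc n) l =
  ⊑-cons (fs-⊑-suc l n)

fs-⊑ : ∀ {a x m n} → IsLim a → m ≤′ n → fs a m ⊑⟨ x ⟩ fs a n
fs-⊑ l (≤′-reflexive refl) = ⊑-refl
fs-⊑ l (≤′-step q) = ⊑-trans (fs-⊑ l q) (fs-⊑-suc l _)

FF-inflationary : ∀ a → Inflationary (F suc a)
FF-inflationary a = F-inflationary suc n≤1+n (wf a)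

-- A limit step is an equation. At a successor at least one of the `x + 1` iterations is present,
-- and the others can only increase the value.
F-⊑ : ∀ {a b x} → a ⊑⟨ x ⟩ b → F suc a x ≤ F suc b x
F-⊑ ⊑-refl = ≤-refl
F-⊑ {x = x} (⊑-suc {p = p} s q) rewrite F-suc suc s x =
  ≤-trans (F-⊑ q) (fold-monoʳ (FF-inflationary p) (s≤s (z≤n {x})))
F-⊑ {x = x} (⊑-lim l q) rewrite F-lim suc l x = F-⊑ q

F-increasing : ∀ a x → x < F suc a x
F-increasing a x = ≤-trans (≤-reflexive (sym (F-𝟎 suc x))) (F-⊑ (⊑-𝟎 (wf a)))

-- In the limit case the argument is first raised at the fixed index `fs a x`; the Bachmann property
-- then gives `fs a x ⊑⟨ y ⟩ fs a y`, a descent at the new argument `y`.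
F-monotone : ∀ {a} → Wf a → Monotone (F suc a)
F-monotone wf-𝟎 {x} {y} x≤y rewrite F-𝟎 suc x | F-𝟎 suc y = s≤s x≤y
F-monotone (wf-suc {p = p} s w) {x} {y} x≤y rewrite F-suc suc s x | F-suc suc s y =
  ≤-trans (fold-monoˡ (F-monotone w) (suc x) x≤y) (fold-monoʳ (FF-inflationary p) (s≤s x≤y))
F-monotone (wf-lim l w) {x} {y} x≤y rewrite F-lim suc l x | F-lim suc l y =
  ≤-trans (F-monotone (w x) x≤y) (F-⊑ (fs-⊑ l (≤⇒≤′ x≤y)))

-- Norms

-- For CNF terms, b ≺ rep a n says that ω^a occurs at most n times at the head of ω^ a ⊕ b.
Norm≤ : ℕ → OT → Set
Norm≤ n 𝟎 = ⊤
Norm≤ n (ω^ a ⊕ b) = Norm≤ n a × Norm≤ n b × b ≺ rep a n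

rep≺ : ∀ {a} m n → m < n → rep a m ≺ rep a n
rep≺ zero (suc n) _ = 𝟎≺
rep≺ (suc m) (suc n) (s≤s m<n) = tail (rep≺ m n m<n)

≺-rep-mono : ∀ {a b m n} → m ≤ n → b ≺ rep a m → b ≺ rep a n
≺-rep-mono {m = m} {n} m≤n p with m≤n⇒m<n∨m≡n m≤n
... | inj₁ m<n = ≺-trans p (rep≺ m n m<n)
... | inj₂ refl = p

Norm≤-mono : ∀ {m n} a → m ≤ n → Norm≤ m a → Norm≤ n a
Norm≤-mono 𝟎 m≤n _ = tt
Norm≤-mono (ω^ a ⊕ b) m≤n (p , q , r) =
  Norm≤-mono a m≤n p , Norm≤-mono b m≤n q , ≺-rep-mono m≤n r

tail-norm : ∀ {a b} → CNF b → LeadLE b a → ∃[ n ] b ≺ rep a n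
tail-norm cnf𝟎 _ = 1 , 𝟎≺
tail-norm (cnfω _ c l) c≤a with ≤ₒ⇒≺⊎≡ c≤a
... | inj₁ p = 1 , lead p
... | inj₂ refl with tail-norm c l
...   | n , p = suc n , tail p

norm : ∀ {a} → CNF a → ∃[ n ] Norm≤ n a
norm cnf𝟎 = 0 , tt
norm {ω^ a ⊕ b} (cnfω ca cb l) with norm ca | norm cb | tail-norm cb l
... | i , p | j , q | k , r = i + j + k ,
  Norm≤-mono a (≤-trans (m≤m+n i j) (m≤m+n (i + j) k)) p ,
  Norm≤-mono b (≤-trans (m≤n+m j i) (m≤m+n (i + j) k)) q ,
  ≺-rep-mono (m≤n+m k (i + j)) r

Norm≤-pred : ∀ {a p n} → IsSuc a p → Norm≤ n a → Norm≤ n p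
Norm≤-pred one _ = tt
Norm≤-pred (cons s) (p , q , r) = p , Norm≤-pred s q , ≺-trans (pred≺ s) r

Norm≤-rep : ∀ {a} m n → m ≤ n → Norm≤ n a → Norm≤ n (rep a m)
Norm≤-rep zero n _ _ = tt
Norm≤-rep (suc m) n m<n p = p , Norm≤-rep m n (<⇒≤ m<n) p , rep≺ m n m<n

Norm≤-fs : ∀ {a n x} → IsLim a → x < n → Norm≤ n a → Norm≤ n (fs a x)
Norm≤-fs {n = n} {x} (ω-suc s) x<n (p , _ , _) rewrite fs-ω-suc x s =
  Norm≤-rep (suc x) n x<n (Norm≤-pred s p)
Norm≤-fs {n = suc n} {x} (ω-lim l) x<n (p , _ , _) rewrite fs-ω-lim x l =
  Norm≤-fs l x<n p , tt , 𝟎≺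
Norm≤-fs {ω^ a ⊕ b} {n} {x} (cons l) x<n (p , q , r) rewrite fs-cons {a} x l =
  p , Norm≤-fs l x<n q , ≺-trans (fs≺ x l) r

≺-suc⇒⪯ : ∀ {a b p} → IsSuc b p → a ≺ b → a ≺ p ⊎ a ≡ p
≺-suc⇒⪯ one 𝟎≺ = inj₂ refl
≺-suc⇒⪯ (cons s) 𝟎≺ = inj₁ 𝟎≺
≺-suc⇒⪯ (cons s) (lead p) = inj₁ (lead p)
≺-suc⇒⪯ (cons s) (tail p) with ≺-suc⇒⪯ s p
... | inj₁ q = inj₁ (tail q)
... | inj₂ refl = inj₂ refl

-- The tight case is `tail r`, where `b` is `ω^(p+1)` and `a` begins with `ω^p`: by the norm the
-- rest of `a` is below `rep p n`, which is what `fs b n` has after its first `ω^p`.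
≺-fs : ∀ {a b n} → IsLim b → Norm≤ n a → a ≺ b → a ≺ fs b n
≺-fs {n = n} l _ 𝟎≺ = fs-positive n l
≺-fs {n = n} (ω-suc s) (_ , _ , r) (lead p) rewrite fs-ω-suc n s with ≺-suc⇒⪯ s p
... | inj₁ q = lead q
... | inj₂ refl = tail r
≺-fs {n = n} (ω-lim l) (q , _ , _) (lead p) rewrite fs-ω-lim n l = lead (≺-fs l q p)
≺-fs {b = ω^ c ⊕ _} {n} (cons l) _ (lead p) rewrite fs-cons {c} n l = lead p
≺-fs {b = ω^ c ⊕ _} {n} (cons l) (_ , q , _) (tail p) rewrite fs-cons {c} n l =
  tail (≺-fs l q p)

-- Descending from `b` at argument `n` cannot jump over `a`: at successors by `≺-suc⇒⪯`, at limits
-- by `≺-fs`. Since `Wf b` makes the descent finite, it arrives at `a`.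
≺⇒⊑ : ∀ {a b n} → Wf b → Norm≤ n a → a ≺ b → a ⊑⟨ n ⟩ b
≺⇒⊑ (wf-suc s w) k p with ≺-suc⇒⪯ s p
... | inj₁ q = ⊑-suc s (≺⇒⊑ w k q)
... | inj₂ refl = ⊑-suc s ⊑-refl
≺⇒⊑ (wf-lim l w) k p = ⊑-lim l (≺⇒⊑ (w _) k (≺-fs l k p))

-- Ordinal addition

+ₒ-identityʳ : ∀ a → a +ₒ 𝟎 ≡ a
+ₒ-identityʳ 𝟎 = refl
+ₒ-identityʳ (ω^ a ⊕ b) = cong (ω^ a ⊕_) (+ₒ-identityʳ b)

+ₒ-suc : ∀ a {b p} → IsSuc b p → IsSuc (a +ₒ b) (a +ₒ p)
+ₒ-suc 𝟎 s = s
+ₒ-suc (ω^ 𝟎 ⊕ b) one = cons (+ₒ-suc b one)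
+ₒ-suc (ω^ (ω^ _ ⊕ _) ⊕ b) one = cons (+ₒ-suc b one)
+ₒ-suc (ω^ a ⊕ b) (cons {e} s) with cmp a e
... | lt = cons s
... | eq = cons (+ₒ-suc b (cons s))
... | gt = cons (+ₒ-suc b (cons s))

+ₒ-lim : ∀ a {b} → IsLim b → IsLim (a +ₒ b)
+ₒ-lim 𝟎 l = l
+ₒ-lim (ω^ a ⊕ b) {ω^ e ⊕ _} l with cmp a e
... | lt = l
... | eq = cons (+ₒ-lim b l)
... | gt = cons (+ₒ-lim b l)

+ₒ-monoʳ-≺ : ∀ a {b c} → b ≺ c → a +ₒ b ≺ a +ₒ c
+ₒ-monoʳ-≺ 𝟎 p = p
+ₒ-monoʳ-≺ (ω^ a ⊕ a′) {𝟎} {ω^ e ⊕ f} p with cmp a e | comparison a e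
... | lt | less q = lead q
... | eq | _ = tail (+ₒ-monoʳ-≺ a′ p)
... | gt | _ = tail (+ₒ-monoʳ-≺ a′ p)
+ₒ-monoʳ-≺ (ω^ a ⊕ a′) {ω^ g ⊕ _} {ω^ e ⊕ _} (tail p) with cmp a g
... | lt = tail p
... | eq = tail (+ₒ-monoʳ-≺ a′ (tail p))
... | gt = tail (+ₒ-monoʳ-≺ a′ (tail p))
+ₒ-monoʳ-≺ (ω^ a ⊕ a′) {ω^ g ⊕ _} {ω^ e ⊕ _} (lead p)
  with cmp a g | comparison a g | cmp a e | comparison a e
... | lt | less q | lt | _ = lead p
... | lt | less q | eq | same = contradiction (≺-trans q p) ≺-irrefl
... | lt | less q | gt | greater r = contradiction (≺-trans (≺-trans q p) r) ≺-irrefl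
... | eq | _ | lt | less r = lead r
... | gt | _ | lt | less r = lead r
... | eq | _ | eq | _ = tail (+ₒ-monoʳ-≺ a′ (lead p))
... | eq | _ | gt | _ = tail (+ₒ-monoʳ-≺ a′ (lead p))
... | gt | _ | eq | _ = tail (+ₒ-monoʳ-≺ a′ (lead p))
... | gt | _ | gt | _ = tail (+ₒ-monoʳ-≺ a′ (lead p))

LeadLE-+ₒ : ∀ {a} b {c} → LeadLE b a → LeadLE c a → LeadLE (b +ₒ c) a
LeadLE-+ₒ 𝟎 p q = q
LeadLE-+ₒ (ω^ b ⊕ _) {𝟎} p q = p
LeadLE-+ₒ (ω^ b ⊕ _) {ω^ e ⊕ _} p q with cmp b e
... | lt = q
... | eq = p
... | gt = p

CNF-+ₒ : ∀ {a b} → CNF a → CNF b → CNF (a +ₒ b)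
CNF-+ₒ cnf𝟎 cb = cb
CNF-+ₒ (cnfω {a} {b} ca cb l) cnf𝟎 = subst CNF (sym (+ₒ-identityʳ _)) (cnfω ca cb l)
CNF-+ₒ (cnfω {a} {b} ca cb l) cc@(cnfω {e} _ _ _) with cmp a e | comparison a e
... | lt | _ = cc
... | eq | same = cnfω ca (CNF-+ₒ cb cc) (LeadLE-+ₒ b l (inj₂ (cmp-refl a)))
... | gt | greater p = cnfω ca (CNF-+ₒ cb cc) (LeadLE-+ₒ b l (inj₁ (≺⇒<ₒ p)))

-- The asymmetric bounds count copies of `ω^a`: for CNF terms there are at most `m - 1` in `b` and
-- at most `n` in `c`, hence fewer than `m + n` in the sum.
+ₒ-≺-rep : ∀ {a m n} b {c} → b ≺ rep a m → c ≺ rep a (suc n) → b +ₒ c ≺ rep a (m + n)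
+ₒ-≺-rep {m = suc m} {n} 𝟎 _ q = ≺-rep-mono (s≤s (m≤n+m n m)) q
+ₒ-≺-rep {m = suc m} (ω^ _ ⊕ _) {𝟎} (lead p) q = lead p
+ₒ-≺-rep {m = suc m} (ω^ _ ⊕ b) {𝟎} (tail p) q = tail (+ₒ-≺-rep b p q)
+ₒ-≺-rep {m = suc m} {n} (ω^ b ⊕ b′) {ω^ e ⊕ _} p q with cmp b e
+ₒ-≺-rep {m = suc m} {n} (ω^ b ⊕ b′) {ω^ e ⊕ _} p q | lt = ≺-rep-mono (s≤s (m≤n+m n m)) q
+ₒ-≺-rep {m = suc m} {n} (ω^ b ⊕ b′) {ω^ e ⊕ _} (lead p) q | eq = lead p
+ₒ-≺-rep {m = suc m} {n} (ω^ b ⊕ b′) {ω^ e ⊕ _} (tail p) q | eq = tail (+ₒ-≺-rep b′ p q)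
+ₒ-≺-rep {m = suc m} {n} (ω^ b ⊕ b′) {ω^ e ⊕ _} (lead p) q | gt = lead p
+ₒ-≺-rep {m = suc m} {n} (ω^ b ⊕ b′) {ω^ e ⊕ _} (tail p) q | gt = tail (+ₒ-≺-rep b′ p q)

Norm≤-+ₒ : ∀ {m n} a b → Norm≤ m a → Norm≤ n b → Norm≤ (m + n) (a +ₒ b)
Norm≤-+ₒ {m} {n} 𝟎 b _ q = Norm≤-mono b (m≤n+m n m) q
Norm≤-+ₒ {m} {n} a@(ω^ _ ⊕ _) 𝟎 p _ =
  subst (Norm≤ (m + n)) (sym (+ₒ-identityʳ a)) (Norm≤-mono a (m≤m+n m n) p)
Norm≤-+ₒ {m} {n} (ω^ a ⊕ a′) b@(ω^ e ⊕ f) (p , p′ , r) q@(_ , _ , t)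
  with cmp a e | comparison a e
... | lt | _ = Norm≤-mono b (m≤n+m n m) q
... | eq | same = Norm≤-mono a (m≤m+n m n) p , Norm≤-+ₒ a′ b p′ q , +ₒ-≺-rep a′ r (tail t)
... | gt | greater u =
  Norm≤-mono a (m≤m+n m n) p , Norm≤-+ₒ a′ b p′ q , +ₒ-≺-rep a′ r (lead u)

-- Comparison of F_{h,α} with F_{β+α}

module _ {h : ℕ → ℕ} (h-infl : Inflationary h) {b : OT} {k l : ℕ} (G : ℕ → ℕ)
         (G-large : ∀ x → l + (x + suc k) ≤ G x) (norm-b : Norm≤ l b) where

  private
    x≤Gx : ∀ x → x ≤ G x
    x≤Gx x = ≤-trans (m≤m+n x (suc k)) (≤-trans (m≤n+m _ l) (G-large x))

    F-+ₒ-suc : ∀ {a p} → IsSuc a p → ∀ x →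
      (∀ {z} → x ≤ z → G (F h p z) ≤ F suc (b +ₒ p) (G z)) →
      G (F h a x) ≤ F suc (b +ₒ a) (G x)
    F-+ₒ-suc {p = p} s x e rewrite F-suc h s x | F-suc suc (+ₒ-suc b s) (G x) = ≤-trans
      (fold-transfer G (F-inflationary h h-infl (wf p)) (F-monotone (wf (b +ₒ p))) e (suc x))
      -- There are `x + 1` iterations on the left and `G x + 1` on the right.
      (fold-monoʳ (FF-inflationary (b +ₒ p)) (s≤s (x≤Gx x)))

  -- The norm bound `x + suc k` is the invariant: it survives predecessors and larger arguments, and
  -- `suc k` provides the strict `x < x + suc k` that `Norm≤-fs` asks for. The descent from a
  -- positive term ends at `oneₒ`, where `base` enters.
  F-+ₒ-positive : (∀ x → G (F h oneₒ x) ≤ F suc (b +ₒ oneₒ) (G x)) →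
    ∀ {a} → Wf a → 𝟎 ≺ a → ∀ x → Norm≤ (x + suc k) a → G (F h a x) ≤ F suc (b +ₒ a) (G x)
  F-+ₒ-positive base wf-𝟎 ()
  F-+ₒ-positive base (wf-suc one w) _ x _ = base x
  F-+ₒ-positive base (wf-suc s@(cons _) w) _ x n = F-+ₒ-suc s x λ {z} x≤z →
    F-+ₒ-positive base w 𝟎≺ z
      (Norm≤-mono _ (+-monoˡ-≤ (suc k) x≤z) (Norm≤-pred s n))
  F-+ₒ-positive base {a} (wf-lim m w) _ x n rewrite F-lim h m x = ≤-trans
    (F-+ₒ-positive base (w x) (fs-positive x m) x n′)
    -- `G-large` keeps the norm of `b +ₒ fs a x` within the argument `G x` of the descent.
    (F-⊑ (≺⇒⊑ (wf (b +ₒ a))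
      (Norm≤-mono (b +ₒ fs a x) (G-large x) (Norm≤-+ₒ b (fs a x) norm-b n′))
      (+ₒ-monoʳ-≺ b (fs≺ x m))))
    where
    n′ : Norm≤ (x + suc k) (fs a x)
    n′ = Norm≤-fs m (m<m+n x (s≤s z≤n)) n

  module _ (base : ∀ x → G (h x) ≤ F suc b (G x)) where

    private
      base-𝟎 : ∀ x → G (F h 𝟎 x) ≤ F suc (b +ₒ 𝟎) (G x)
      base-𝟎 x rewrite F-𝟎 h x | +ₒ-identityʳ b = base x

    F-+ₒ-one : ∀ x → G (F h oneₒ x) ≤ F suc (b +ₒ oneₒ) (G x)
    F-+ₒ-one x = F-+ₒ-suc one x (λ {z} _ → base-𝟎 z)

    F-+ₒ : ∀ a x → Norm≤ (x + suc k) a → G (F h a x) ≤ F suc (b +ₒ a) (G x)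
    F-+ₒ 𝟎 x _ = base-𝟎 x
    F-+ₒ a@(ω^ _ ⊕ _) x n = F-+ₒ-positive F-+ₒ-one (wf a) 𝟎≺ x n

-- Majorants of the extended Grzegorczyk classes

-- Adding x makes D α dominate addition even when α = 0.
D : OT → ℕ → ℕ
D a x = F suc a x + x

D-monotone : ∀ a → Monotone (D a)
D-monotone a x≤y = +-mono-≤ (F-monotone (wf a) x≤y) x≤y

D-increasing : ∀ a x → x < D a x
D-increasing a x = ≤-trans (F-increasing a x) (m≤m+n _ x)

D-inflationary : ∀ a → Inflationary (D a)
D-inflationary a x = <⇒≤ (D-increasing a x)

F≤D : ∀ a x → F suc a x ≤ D a x
F≤D a x = m≤m+n _ x

D-doubles : ∀ a x → suc (x + x) ≤ D a x
D-doubles a x = +-monoˡ-≤ x (F-increasing a x)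

lookup≤maxV : ∀ {k} (v : Vec ℕ k) i → lookup v i ≤ maxV v
lookup≤maxV (x ∷ v) zero = m≤m⊔n x (maxV v)
lookup≤maxV (x ∷ v) (suc i) = ≤-trans (lookup≤maxV v i) (m≤n⊔m x (maxV v))

maxV-tabulate≤ : ∀ {k n} (f : Fin k → ℕ) → (∀ i → f i ≤ n) → maxV (tabulate f) ≤ n
maxV-tabulate≤ {zero} f p = z≤n
maxV-tabulate≤ {suc k} f p =
  ⊔-lub (p zero) (maxV-tabulate≤ (λ i → f (suc i)) (λ i → p (suc i)))

-- Iteration counts add under composition, once the inner ones are raised to a common maximum. A
-- limited recursion inherits the majorant of its bounding function, so the recursion itself is
-- never estimated.
Grz-majorant : ∀ {a k f} → Grz a k f → ∃[ c ] (∀ v → f v ≤ fold (maxV v) (D a) c)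
Grz-majorant gZero = 0 , λ _ → z≤n
Grz-majorant {a} gAdd = 1 , λ { (x ∷ y ∷ []) →
  ≤-trans (+-mono-≤ (m≤m⊔n x _) (≤-trans (m≤m⊔n y 0) (m≤n⊔m x _)))
    (<⇒≤ (D-doubles a _)) }
Grz-majorant (gProj i) = 0 , λ v → lookup≤maxV v i
Grz-majorant {a} (gF f g) = 1 , λ { (x ∷ []) →
  subst (f x ≤_) (cong (D a) (sym (⊔-identityʳ x)))
    (≤-trans (≤-reflexive (FG-functional suc (g x) (F-graph suc a x))) (F≤D a x)) }
Grz-majorant {a} (gComp {gs = gs} f g) with Grz-majorant f
... | c , f≤ = c + C , λ v → ≤-trans (f≤ _) (≤-trans
        (fold-monoˡ (D-monotone a) c (maxV-tabulate≤ (λ i → gs i v) λ i →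
          ≤-trans (proj₂ (bound i) v)
            (fold-monoʳ (D-inflationary a)
              (subst (_≤ C) (lookup∘tabulate _ i) (lookup≤maxV (tabulate (λ i → proj₁ (bound i))) i)))))
        (≤-reflexive (sym (fold-+ (maxV v) (D a) c))))
  where
  bound : ∀ i → ∃[ d ] (∀ v → gs i v ≤ fold (maxV v) (D a) d)
  bound i = Grz-majorant (g i)
  C : ℕ
  C = maxV (tabulate (λ i → proj₁ (bound i)))
Grz-majorant {a} (gLPR {b = f} _ _ b p) with Grz-majorant b
... | c , b≤ = c , λ v → ≤-trans (p v)
        (subst (λ m → f (maxV v ∷ []) ≤ fold m (D a) c) (⊔-identityʳ (maxV v)) (b≤ (maxV v ∷ [])))
Grz-majorant (gExt f e) with Grz-majorant f
... | c , f≤ = c , λ v → subst (_≤ _) (e v) (f≤ v)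

𝓕-majorant : ∀ {a f} → f ∈𝓕 a → ∃[ c ] (∀ x → f x ≤ fold x (D a) c)
𝓕-majorant {a} {f} g with Grz-majorant g
... | c , f≤ = c , λ x → subst (λ m → f x ≤ fold m (D a) c) (⊔-identityʳ x) (f≤ (x ∷ []))

D∈𝓕 : ∀ a → D a ∈𝓕 a
D∈𝓕 a = gExt
  (gComp {gs = λ { zero v → F suc a (head v) ; (suc _) v → lookup v zero }} gAdd
    λ { zero → gF (F suc a) (F-graph suc a) ; (suc zero) → gProj zero })
  λ { (_ ∷ []) → refl }

fold∈𝓕 : ∀ {a f} → f ∈𝓕 a → ∀ n → (λ x → fold x f n) ∈𝓕 a
fold∈𝓕 g zero = gExt (gProj zero) λ { (_ ∷ []) → refl }
fold∈𝓕 g (suc n) = gComp g (λ _ → fold∈𝓕 g n)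

-- The comparison with `h = suc` and `G x = x + K` gives `F_a x + K ≤ F_{b+a} (x + K)`. The shift of
-- the starting point is then covered by `K` further iterations of `D (b +ₒ a)`.
𝓕-+ₒ-majorant : ∀ {a b f k l} → Norm≤ k a → Norm≤ l b → f ∈𝓕 a →
  ∃[ c ] (∀ x → f x ≤ fold x (D (b +ₒ a)) c)
𝓕-+ₒ-majorant {a} {b} {f} {k} {l} norm-a norm-b f∈ with 𝓕-majorant {f = f} f∈
... | c , f≤ = c + K , λ x → begin
    f x                                    ≤⟨ f≤ x ⟩
    fold x (D a) c                         ≤⟨ m≤m+n _ K ⟩
    fold x (D a) c + K
      ≤⟨ fold-transfer (_+ K) (D-inflationary a) (D-monotone b+a) (λ {z} _ → D-shift z) c ⟩
    fold (x + K) (D b+a) c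
      ≤⟨ fold-monoˡ (D-monotone b+a) c (fold-advance (D-increasing b+a) K x) ⟩
    fold (fold x (D b+a) K) (D b+a) c      ≡⟨ fold-+ x (D b+a) c ⟨
    fold x (D b+a) (c + K)                 ∎
  where
  open ≤-Reasoning
  b+a = b +ₒ a
  K = l + suc k
  F-shift : ∀ x → F suc a x + K ≤ F suc b+a (x + K)
  F-shift x = F-+ₒ n≤1+n {b = b} {k} {l} (_+ K) (λ y → ≤-reflexive (x∙yz≈y∙xz l y (suc k))) norm-b
    (λ y → F-increasing b (y + K)) a x (Norm≤-mono a (≤-trans (n≤1+n k) (m≤n+m _ x)) norm-a)
  D-shift : ∀ x → D a x + K ≤ D b+a (x + K)
  D-shift x = begin
    F suc a x + x + K           ≡⟨ xy∙z≈xz∙y (F suc a x) x K ⟩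
    F suc a x + K + x           ≤⟨ +-mono-≤ (F-shift x) (m≤m+n x K) ⟩
    F suc b+a (x + K) + (x + K) ∎

-- Time bounds

module _ {σ : ℕ} (M : TM σ) where
  open TM M

  run-+ : ∀ m n c → run M (m + n) c ≡ run M n (run M m c)
  run-+ zero n c = refl
  run-+ (suc m) n c = run-+ m n (step M c)

  run-halted : ∀ {b} n c → Config.state c ≡ halt b → Config.state (run M n c) ≡ halt b
  run-halted zero c e = e
  run-halted (suc n) (conf (halt _) _ _ _) e = run-halted n _ e

  run-halted-≤ : ∀ {b} m n c → m ≤ n → Config.state (run M m c) ≡ halt b →
    Config.state (run M n c) ≡ halt b
  run-halted-≤ {b} m n c m≤n e = subst (λ k → Config.state (run M k c) ≡ halt b) (m+[n∸m]≡n m≤n)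
    (trans (cong Config.state (run-+ m (n ∸ m) c)) (run-halted (n ∸ m) _ e))

-- Inclusion of the complexity classes

Doubling : (ℕ → ℕ) → Set
Doubling f = ∀ x → suc (x + x) ≤ f x

-- The machine stays the same; only the inner bound changes, from `p` to a `p′` dominating `G ∘ p`.
-- The bound on `G` is uniform over doubling functions because the level `g` of `p` is not known
-- when `G` is chosen.
𝐅ʰ⊆𝐅 : ∀ {h a b k l} → Inflationary h → CNF a → CNF b → Norm≤ k a → Norm≤ l b →
  (G : ℕ → ℕ) → (∀ x → l + (x + suc k) ≤ G x) →
  ∀ j → (∀ {f} → Doubling f → ∀ x → G x ≤ fold x f j) →
  (∀ x → G (F h oneₒ x) ≤ F suc (b +ₒ oneₒ) (G x)) →
  ∀ σ (L : Lang σ) → 𝐅ʰ[ h , a ] σ L → 𝐅[ b +ₒ a ] σ L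
𝐅ʰ⊆𝐅 {h} {a} {b} {k} {l} h-infl ca cb norm-a norm-b G G-large j G-small base
  σ L (p , (g , cg , g<a , p∈) , M , dec)
  with 𝓕-+ₒ-majorant {f = p} (proj₂ (norm cg)) norm-b p∈
... | c , p≤ = p′ ,
    (b +ₒ g , CNF-+ₒ cb cg , ≺⇒<ₒ (+ₒ-monoʳ-≺ b g≺a) , fold∈𝓕 (D∈𝓕 (b +ₒ g)) (j + c)) ,
    M , dec′
  where
  open ≤-Reasoning
  d = D (b +ₒ g)
  g≺a : g ≺ a
  g≺a = <ₒ⇒≺ {g} g<a
  p′ : ℕ → ℕ
  p′ x = fold x d (j + c)
  G∘p≤p′ : ∀ x → G (p x) ≤ p′ x
  G∘p≤p′ x = begin
    G (p x)              ≤⟨ G-small (D-doubles (b +ₒ g)) (p x) ⟩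
    fold (p x) d j       ≤⟨ fold-monoˡ (D-monotone (b +ₒ g)) j (p≤ x) ⟩
    fold (fold x d c) d j ≡⟨ fold-+ x d j ⟨
    fold x d (j + c)     ∎
  bound : ∀ x → F h a (p x) ≤ F suc (b +ₒ a) (p′ x)
  bound x = begin
    F h a (p x)                ≤⟨ m≤n+m _ (l + suc k) ⟩
    l + suc k + F h a (p x)    ≡⟨ xy∙z≈x∙zy l (suc k) _ ⟩
    l + (F h a (p x) + suc k)  ≤⟨ G-large _ ⟩
    G (F h a (p x))
      -- `g ≺ a` makes `a` positive, so the inequality at `oneₒ` is a sufficient base.
      ≤⟨ F-+ₒ-positive h-infl {b = b} {k} {l} G G-large norm-b base (wf a) (≺⇒𝟎≺ g≺a) (p x)
           (Norm≤-mono a (≤-trans (n≤1+n k) (m≤n+m _ (p x))) norm-a) ⟩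
    F suc (b +ₒ a) (G (p x))   ≤⟨ F-monotone (wf (b +ₒ a)) (G∘p≤p′ x) ⟩
    F suc (b +ₒ a) (p′ x)      ∎
  dec′ : DecidesIn M (λ n t → FF (b +ₒ a) (p′ n) t) L
  dec′ w with dec w
  ... | t , T , e = _ , F-graph suc (b +ₒ a) (p′ (length w)) , run-halted-≤ M t
    (F suc (b +ₒ a) (p′ (length w))) (initConf M w)
    (subst (_≤ _) (FG-functional h (F-graph h a _) T) (bound (length w))) e

-- Growth of strictly increasing and of doubling functions

strictlyIncreasing⇒+-≤ : ∀ {h} → StrictlyIncreasing h → ∀ k x → h x + k ≤ h (x + k)
strictlyIncreasing⇒+-≤ {h} h-inc zero x =
  ≤-reflexive (trans (+-identityʳ (h x)) (cong h (sym (+-identityʳ x))))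
strictlyIncreasing⇒+-≤ {h} h-inc (suc k) x rewrite +-suc (h x) k | +-suc x k =
  ≤-trans (s≤s (strictlyIncreasing⇒+-≤ h-inc k x)) (h-inc ≤-refl)

strictlyIncreasing⇒inflationary : ∀ {h} → StrictlyIncreasing h → Inflationary h
strictlyIncreasing⇒inflationary {h} h-inc x =
  ≤-trans (m≤n+m x (h 0)) (strictlyIncreasing⇒+-≤ h-inc x 0)

n<2^n : ∀ n → n < 2 ^ n
n<2^n zero = s≤s z≤n
n<2^n (suc n) = begin-strict
  suc n             ≤⟨ n<2^n n ⟩
  2 ^ n             <⟨ m<m+n (2 ^ n) (≤-<-trans z≤n (n<2^n n)) ⟩
  2 ^ n + 2 ^ n     ≡⟨ cong (2 ^ n +_) (+-identityʳ (2 ^ n)) ⟨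
  2 ^ suc n         ∎
  where open ≤-Reasoning

-- One application of a doubling function at least doubles the successor of its argument.
doubling-fold : ∀ f → Doubling f → ∀ n x → 2 ^ n * suc x ≤ suc (fold x f n)
doubling-fold f f2 zero x = ≤-reflexive (*-identityˡ (suc x))
doubling-fold f f2 (suc n) x = begin
  2 * 2 ^ n * suc x         ≡⟨ *-assoc 2 (2 ^ n) (suc x) ⟩
  2 * (2 ^ n * suc x)       ≤⟨ *-monoʳ-≤ 2 (doubling-fold f f2 n x) ⟩
  2 * suc z                 ≡⟨ cong suc (cong (z +_) (+-identityʳ (suc z))) ⟩
  suc (z + suc z)           ≡⟨ cong suc (+-suc z z) ⟩
  suc (suc (z + z))         ≤⟨ s≤s (f2 z) ⟩
  suc (f z)                 ∎
  where
  open ≤-Reasoning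
  z = fold x f n

2^*suc≤fold : ∀ f → Doubling f → ∀ n x → 2 ^ n * suc x ≤ fold x f (suc n)
2^*suc≤fold f f2 n x = ≤-trans (doubling-fold f f2 n x) (≤-trans (s≤s (m≤m+n _ _)) (f2 _))

fold-fold : ∀ (f g : ℕ → ℕ) {c} → Monotone g → (∀ x → f x ≤ fold x g c) →
  ∀ n x → fold x f n ≤ fold x g (n * c)
fold-fold f g gm f≤ zero x = ≤-refl
fold-fold f g {c} gm f≤ (suc n) x = begin
  f (fold x f n)              ≤⟨ f≤ _ ⟩
  fold (fold x f n) g c       ≤⟨ fold-monoˡ gm c (fold-fold f g gm f≤ n x) ⟩
  fold (fold x g (n * c)) g c ≡⟨ fold-+ x g c ⟨
  fold x g (c + n * c)        ∎
  where open ≤-Reasoning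

-- `F_{a+1} x` applies `F_a` once to reach `F_a x` and then `x` more times, each adding at least
-- one.
D≤F-suc : ∀ a x → D a x ≤ F suc (a +ₒ oneₒ) x
D≤F-suc a x rewrite F-suc suc (+ₒ-suc a one) x | +ₒ-identityʳ a | fold-tail (F suc a) x {x} =
  fold-advance (F-increasing a) x (F suc a x)

-- Part (i): functions in the class of β

module _ {h : ℕ → ℕ} (h-infl : Inflationary h) {a b : OT}
         (ca : CNF a) (cb : CNF b) (h∈ : h ∈𝓕 b) where
  open ≤-Reasoning

  private
    b₁ : OT
    b₁ = b +ₒ oneₒ
    cb₁ : CNF b₁
    cb₁ = CNF-+ₒ cb (cnfω cnf𝟎 cnf𝟎 tt)
    f : ℕ → ℕ
    f = F suc b₁
    c k l n m : ℕ
    c = proj₁ (𝓕-majorant {f = h} h∈)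
    k = proj₁ (norm ca)
    l = proj₁ (norm cb₁)
    -- `n` covers both `c` and the norms. With `m = suc n`, both `m` and `c` are at most `2 ^ n`,
    -- whence `m + c ≤ 2 ^ m`.
    n = c + (l + suc k)
    m = suc n
    f-mono : Monotone f
    f-mono = F-monotone (wf b₁)
    f-infl : Inflationary f
    f-infl = FF-inflationary b₁

    -- When b = 0 no function of the form x + K works for G: h may grow like 4x,
    -- whereas F_1 x = 2x + 1.
    G : ℕ → ℕ
    G x = 2 ^ m * suc x

    h≤fold : ∀ x → h x ≤ fold x f c
    h≤fold x = ≤-trans (proj₂ (𝓕-majorant {f = h} h∈) x)
      (fold-transfer (λ y → y) (D-inflationary b) f-mono (λ {z} _ → D≤F-suc b z) c)

    f-doubling : Doubling f
    f-doubling x = ≤-trans (D-doubles b x) (D≤F-suc b x)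

    m+c≤2^m : m + c ≤ 2 ^ m
    m+c≤2^m = begin
      m + c             ≤⟨ +-mono-≤ (n<2^n n) (≤-trans (m≤m+n c _) (<⇒≤ (n<2^n n))) ⟩
      2 ^ n + 2 ^ n     ≡⟨ cong (2 ^ n +_) (+-identityʳ (2 ^ n)) ⟨
      2 ^ m             ∎

    G-large : ∀ x → l + (x + suc k) ≤ G x
    G-large x = begin
      l + (x + suc k)          ≡⟨ x∙yz≈y∙xz l x (suc k) ⟩
      x + (l + suc k)          ≤⟨ +-mono-≤ (n≤1+n x) (≤-trans (m≤n+m _ c) (m≤m*n n (suc x))) ⟩
      suc n * suc x            ≤⟨ *-monoˡ-≤ (suc x) (≤-trans (m≤m+n m c) m+c≤2^m) ⟩
      G x                      ∎

    -- The budget of iterations of `f`: `suc m` pay for the outer `G` and `c` for each of the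
    -- `x + 1` applications of `h`, while `F_{b₁+1} (G x)` grants `G x + 1`.
    exponent : ∀ x → suc m + suc x * c ≤ suc (G x)
    exponent x = s≤s (begin
      m + suc x * c        ≤⟨ +-mono-≤ (m≤m*n m (suc x)) (≤-reflexive (*-comm (suc x) c)) ⟩
      m * suc x + c * suc x ≡⟨ *-distribʳ-+ (suc x) m c ⟨
      (m + c) * suc x      ≤⟨ *-monoˡ-≤ (suc x) m+c≤2^m ⟩
      G x                  ∎)

    F-one : ∀ x → F h oneₒ x ≤ fold x f (suc x * c)
    F-one x rewrite F-suc h one x = fold-fold (F h 𝟎) f {c} f-mono
      (λ y → subst (_≤ fold y f c) (sym (F-𝟎 h y)) (h≤fold y)) (suc x) x

    base : ∀ x → G (F h oneₒ x) ≤ F suc (b₁ +ₒ oneₒ) (G x)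
    base x rewrite F-suc suc (+ₒ-suc b₁ one) (G x) | +ₒ-identityʳ b₁ = begin
      G (F h oneₒ x)                       ≤⟨ 2^*suc≤fold f f-doubling m (F h oneₒ x) ⟩
      fold (F h oneₒ x) f (suc m)          ≤⟨ fold-monoˡ {f} f-mono (suc m) (F-one x) ⟩
      fold (fold x f (suc x * c)) f (suc m) ≡⟨ fold-+ x f (suc m) ⟨
      fold x f (suc m + suc x * c)         ≤⟨ fold-monoʳ f-infl (exponent x) ⟩
      fold x f (suc (G x))                 ≤⟨ fold-monoˡ f-mono (suc (G x)) (≤-trans x≤ (G-large x)) ⟩
      fold (G x) f (suc (G x))             ∎
      where
      x≤ : x ≤ l + (x + suc k)
      x≤ = ≤-trans (m≤m+n x _) (m≤n+m _ l)

  𝐅ʰ⊆𝐅-of-∈𝓕 : ∀ σ (L : Lang σ) → 𝐅ʰ[ h , a ] σ L → 𝐅[ b₁ +ₒ a ] σ L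
  𝐅ʰ⊆𝐅-of-∈𝓕 = 𝐅ʰ⊆𝐅 h-infl ca cb₁ (proj₂ (norm ca)) (proj₂ (norm cb₁)) G G-large
    (suc m) (λ {g} g2 x → 2^*suc≤fold g g2 m x) base

theorem4p2 : (h : ℕ → ℕ) → StrictlyIncreasing h →
    (α β : OT) → CNF α → CNF β →
    ((h ∈𝓕 β) → ∀ σ (L : Lang σ) → 𝐅ʰ[ h , α ] σ L → 𝐅[ β +ₒ oneₒ +ₒ α ] σ L)
    × ((∀ x → Σ ℕ (λ y → FF β x y × h x ≤ y)) →
    ∀ σ (L : Lang σ) → 𝐅ʰ[ h , α ] σ L → 𝐅[ β +ₒ α ] σ L)
theorem4p2 h h-inc α β cα cβ = 𝐅ʰ⊆𝐅-of-∈𝓕 h-infl cα cβ , part-ii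
  where
  h-infl : Inflationary h
  h-infl = strictlyIncreasing⇒inflationary h-inc
  part-ii : (∀ x → Σ ℕ (λ y → FF β x y × h x ≤ y)) →
    ∀ σ (L : Lang σ) → 𝐅ʰ[ h , α ] σ L → 𝐅[ β +ₒ α ] σ L
  part-ii h≤ with norm cα | norm cβ
  ... | k , norm-α | l , norm-β = 𝐅ʰ⊆𝐅 h-infl cα cβ norm-α norm-β (_+ K) shift-large K
    (λ f2 → fold-advance (λ x → ≤-trans (s≤s (m≤m+n x x)) (f2 x)) K)
    -- Here the inequality holds for `h` itself, and one successor step carries it to `oneₒ`.
    (F-+ₒ-one h-infl {b = β} {k} {l} (_+ K) shift-large norm-β base)
    where
    K = l + suc k
    shift-large : ∀ x → l + (x + suc k) ≤ x + K
    shift-large x = ≤-reflexive (x∙yz≈y∙xz l x (suc k))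
    base : ∀ x → h x + K ≤ F suc β (x + K)
    base x with h≤ (x + K)
    -- Strict monotonicity moves the shift inside: `h x + K ≤ h (x + K)`.
    ... | y , g , h≤y = ≤-trans (strictlyIncreasing⇒+-≤ h-inc K x)
      (subst (h (x + K) ≤_) (FG-functional suc g (F-graph suc β (x + K))) h≤y)
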